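{- A matroid $M$ (possibly infinite, pointed) is finitary if and only if it is a co-limit of finite matroids, i.e. if and only if $M$ is a co-limit in $\mathbf{Mat}_\bullet$ of a diagram in $\mathbf{Mat}_\bullet$ all of whose objects are matroids with finite ground set.
   Context: A collection $\mathcal{A}$ of subsets of a set $E$ has Property (M) if for all $A \in \mathcal{A}$ and all $S$ with $A \subseteq S \subseteq E$ the collection $\{X \in \mathcal{A} : A \subseteq X \subseteq S\}$ has an inclusion-maximal element. A (possibly infinite) matroid $M$ on a ground set $E = E(M)$ is given by its set $\mathcal{C}$ of circuits, a collection of subsets of $E$ satisfying: (C0) $\emptyset \notin \mathcal{C}$; (CI) distinct elements of $\mathcal{C}$ are incomparable under inclusion; (CE) for all $X \subseteq C \in \mathcal{C}$, all families $\{C_x \in \mathcal{C} : x \in X\}$ such that for $x,y\in X$ one has $x \in C_y$ iff $x = y$, and all $z \in C \setminus \bigcup_{x} C_x$, there is $C' \in \mathcal{C}$ with $z \in C' \subseteq (C \cup \bigcup_x C_x) \setminus X$; (CM) the collection $\{I \subseteq E : C \not\subseteq I \text{ for all } C \in \mathcal{C}\}$ has Property (M). The closure operator is $\mathrm{cl}_M(X) = X \cup \{e \in E : \text{there is a circuit } C \text{ with } e \in C \subseteq X \cup \{e\}\}$. A loop is an element of $\mathrm{cl}_M(\emptyset)$ (equivalently $\{e\}$ is a circuit). A pointed matroid is a matroid with a distinguished loop $\ast$. A strong map $M \to N$ of matroids is a map $f\colon E(M) \to E(N)$ with $f(\mathrm{cl}_M(A)) \subseteq \mathrm{cl}_N(f(A))$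 for all $A \subseteq E(M)$ (equivalently, preimages of closed sets of $N$ are closed in $M$); it is pointed if $f(\ast_M)=\ast_N$. $\mathbf{Mat}_\bullet$ is the category of pointed matroids with pointed strong maps. A matroid is finitary when all of its circuits are finite, and finite when its ground set is finite. -}

module Defs where

open import Level using (Level; suc; _⊔_)
open import Data.Product using (Σ; ∃; _×_; _,_)
open import Data.Sum using (inj₁; inj₂; map₁)
open import Data.List using (List)
import Data.List.Membership.Propositional as List
open import Function using (_⇔_; id; _∘_)
open import Relation.Binary using (Rel; IsEquivalence)
open import Relation.Binary.PropositionalEquality using (_≡_; refl; sym; trans; cong)
open import Relation.Nullary using (¬_)
open import Relation.Unary
  using (Pred; _∈_; _∉_; _⊆_; _≐_; _∪_; _∖_; ∅; U; ｛_｝; Empty)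

private
  variable
    a b c i o h e o′ h′ e′ ℓ : Level

------------------------------------------------------------------------
-- Sets and subsets

image : {A : Set a} {B : Set b} → (A → B) → Pred A c → Pred B (a ⊔ b ⊔ c)
image f X y = ∃ λ x → x ∈ X × f x ≡ y

-- The list may have repetitions; classically this is the usual finiteness.
FiniteSubset : {A : Set a} → Pred A b → Set (a ⊔ b)
FiniteSubset {A = A} X = ∃ λ (xs : List A) → X ≐ (List._∈ xs)

FiniteSet : Set a → Set a
FiniteSet A = FiniteSubset {A = A} U

------------------------------------------------------------------------
-- Matroids

Maximal : {E : Set ℓ} → Pred (Pred E ℓ) i → Pred E ℓ → Set (suc ℓ ⊔ i)
Maximal 𝒜 X = X ∈ 𝒜 × (∀ {Y} → Y ∈ 𝒜 → X ⊆ Y → Y ⊆ X)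

PropertyM : {E : Set ℓ} → Pred (Pred E ℓ) i → Set (suc ℓ ⊔ i)
PropertyM {ℓ} {E = E} 𝒜 =
  ∀ {A S : Pred E ℓ} → A ∈ 𝒜 → A ⊆ S →
  ∃ λ X → Maximal (λ Y → Y ∈ 𝒜 × A ⊆ Y × Y ⊆ S) X

-- Subsets are predicates, whose equality as subsets is _≐_; the field
-- C-resp-≐ says that Circuit is a collection of subsets in this sense.
--
-- In CE, D is defined on all of E, but only its values on X are
-- constrained or used, so it represents a family indexed by X.

record Matroid (ℓ : Level) : Set (suc ℓ) where
  field
    E        : Set ℓ
    Circuit  : Pred (Pred E ℓ) ℓ
    C-resp-≐ : ∀ {C D} → C ≐ D → Circuit C → Circuit D

  Independent : Pred (Pred E ℓ) (suc ℓ)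
  Independent I = ∀ {C} → Circuit C → ¬ (C ⊆ I)

  field
    C0 : ∀ {C} → Circuit C → ¬ Empty C
    CI : ∀ {C D} → Circuit C → Circuit D → ¬ (C ≐ D) → ¬ (C ⊆ D)
    CE : ∀ {C X : Pred E ℓ} → Circuit C → X ⊆ C →
         (D : E → Pred E ℓ) →
         (∀ {x} → x ∈ X → Circuit (D x)) →
         (∀ {x y} → x ∈ X → y ∈ X → (x ∈ D y) ⇔ (x ≡ y)) →
         let ⋃D = λ w → ∃ λ x → x ∈ X × w ∈ D x in
         ∀ {z} → z ∈ C → z ∉ ⋃D →
         ∃ λ C′ → Circuit C′ × z ∈ C′ × C′ ⊆ (C ∪ ⋃D) ∖ X
    CM : PropertyM Independent

  cl : Pred E a → Pred E (suc ℓ ⊔ a)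
  cl X = X ∪ λ x → ∃ λ C → Circuit C × x ∈ C × C ⊆ X ∪ ｛ x ｝

  Loop : Pred E (suc ℓ)
  Loop = cl ∅

  Finitary : Set (suc ℓ)
  Finitary = ∀ {C} → Circuit C → FiniteSubset C

  Finite : Set ℓ
  Finite = FiniteSet E

  cl-mono : {X : Pred E a} {Y : Pred E b} → X ⊆ Y → cl X ⊆ cl Y
  cl-mono X⊆Y (inj₁ x∈X) = inj₁ (X⊆Y x∈X)
  cl-mono X⊆Y (inj₂ (C , circ , x∈C , C⊆)) =
    inj₂ (C , circ , x∈C , λ y∈C → map₁ X⊆Y (C⊆ y∈C))

record PointedMatroid (ℓ : Level) : Set (suc ℓ) where
  field
    matroid : Matroid ℓ
  open Matroid matroid public
  field
    ∗      : E
    ∗-loop : ∗ ∈ Loop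

record PointedStrongMap (M N : PointedMatroid ℓ) : Set (suc ℓ) where
  private
    module M = PointedMatroid M
    module N = PointedMatroid N
  field
    map     : M.E → N.E
    strong  : ∀ (A : Pred M.E ℓ) → image map (M.cl A) ⊆ N.cl (image map A)
    pointed : map M.∗ ≡ N.∗

open PointedStrongMap

------------------------------------------------------------------------
-- Categories, with hom-setoids

record Category (o h e : Level) : Set (suc (o ⊔ h ⊔ e)) where
  infix  4 _≈_ _⇒_
  infixr 9 _∙_
  field
    Obj       : Set o
    _⇒_       : Rel Obj h
    _≈_       : ∀ {A B} → Rel (A ⇒ B) e
    idn       : ∀ {A} → A ⇒ A
    _∙_       : ∀ {A B C} → B ⇒ C → A ⇒ B → A ⇒ C
    equiv     : ∀ {A B} → IsEquivalence (_≈_ {A} {B})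
    ∙-resp-≈  : ∀ {A B C} {f g : B ⇒ C} {k l : A ⇒ B} →
                f ≈ g → k ≈ l → f ∙ k ≈ g ∙ l
    assoc     : ∀ {A B C D} {f : A ⇒ B} {g : B ⇒ C} {k : C ⇒ D} →
                (k ∙ g) ∙ f ≈ k ∙ (g ∙ f)
    identityˡ : ∀ {A B} {f : A ⇒ B} → idn ∙ f ≈ f
    identityʳ : ∀ {A B} {f : A ⇒ B} → f ∙ idn ≈ f

record Functor (J : Category o h e) (𝒞 : Category o′ h′ e′) :
               Set (o ⊔ h ⊔ e ⊔ o′ ⊔ h′ ⊔ e′) where
  private
    module J = Category J
    module 𝒞 = Category 𝒞
  field
    F₀       : J.Obj → 𝒞.Obj
    F₁       : ∀ {A B} → A J.⇒ B → F₀ A 𝒞.⇒ F₀ B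
    F-resp-≈ : ∀ {A B} {f g : A J.⇒ B} → f J.≈ g → F₁ f 𝒞.≈ F₁ g
    F-idn    : ∀ {A} → F₁ (J.idn {A}) 𝒞.≈ 𝒞.idn
    F-∙      : ∀ {A B C} {f : A J.⇒ B} {g : B J.⇒ C} →
               F₁ (g J.∙ f) 𝒞.≈ F₁ g 𝒞.∙ F₁ f

module _ {J : Category o h e} {𝒞 : Category o′ h′ e′} (F : Functor J 𝒞) where
  private
    module J = Category J
  open Category 𝒞
  open Functor F

  record Cocone (N : Obj) : Set (o ⊔ h ⊔ h′ ⊔ e′) where
    field
      leg     : ∀ j → F₀ j ⇒ N
      commute : ∀ {j k} (f : j J.⇒ k) → leg k ∙ F₁ f ≈ leg j

  open Cocone

  Factors : ∀ {M N} → Cocone M → Cocone N → M ⇒ N → Set (o ⊔ e′)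
  Factors κ λ′ u = ∀ j → u ∙ leg κ j ≈ leg λ′ j

  IsColimiting : ∀ {M} → Cocone M → Set (o ⊔ h ⊔ o′ ⊔ h′ ⊔ e′)
  IsColimiting {M} κ = ∀ {N} (λ′ : Cocone N) →
    Σ (M ⇒ N) λ u → Factors κ λ′ u × (∀ v → Factors κ λ′ v → v ≈ u)

  IsColimit : Obj → Set (o ⊔ h ⊔ o′ ⊔ h′ ⊔ e′)
  IsColimit M = Σ (Cocone M) IsColimiting

------------------------------------------------------------------------
-- The category of pointed matroids and pointed strong maps

idMap : {M : PointedMatroid ℓ} → PointedStrongMap M M
idMap {M = M} = record
  { map     = id
  ; strong  = λ { A (x , x∈cl , refl) → cl-mono (λ y∈A → _ , y∈A , refl) x∈cl }
  ; pointed = refl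
  }
  where open PointedMatroid M

compMap : {L M N : PointedMatroid ℓ} →
          PointedStrongMap M N → PointedStrongMap L M → PointedStrongMap L N
compMap {N = N} g f = record
  { map     = map g ∘ map f
  ; strong  = λ { A (x , x∈cl , refl) →
      cl-mono (λ { (_ , (y , y∈A , refl) , refl) → y , y∈A , refl })
        (strong g (image (map f) A)
          (map f x , strong f A (x , x∈cl , refl) , refl)) }
  ; pointed = trans (cong (map g) (pointed f)) (pointed g)
  }
  where open PointedMatroid N

Mat• : (ℓ : Level) → Category (suc ℓ) (suc ℓ) ℓ
Mat• ℓ = record
  { Obj       = PointedMatroid ℓ
  ; _⇒_       = PointedStrongMap
  ; _≈_       = λ f g → ∀ x → map f x ≡ map g x
  ; idn       = idMap
  ; _∙_       = compMap
  ; equiv     = record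
    { refl  = λ _ → refl
    ; sym   = λ p x → sym (p x)
    ; trans = λ p q x → trans (p x) (q x)
    }
  ; ∙-resp-≈  = λ {_} {_} {_} {f} {g} {k} {l} p q x →
      trans (cong (map f) (q x)) (p (map l x))
  ; assoc     = λ _ → refl
  ; identityˡ = λ _ → refl
  ; identityʳ = λ _ → refl
  }

-- The diagrams are small: the shape J lives in the universe of ground sets.
IsColimitOfFinite : PointedMatroid ℓ → Set (suc ℓ)
IsColimitOfFinite {ℓ} M =
  Σ (Category ℓ ℓ ℓ) λ J →
  Σ (Functor J (Mat• ℓ)) λ F →
    (∀ j → PointedMatroid.Finite (Functor.F₀ F j)) × IsColimit F M

{-# OPTIONS --safe #-}

-- A finitary matroid is the colimit of its restrictions to finite sets
-- containing the point, because every circuit is visible in one of them.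
--
-- Conversely, let κ exhibit M as a colimit of finite matroids, let e lie on
-- a circuit C of M, and let H be the closure of C ∖ {e} under the finite
-- circuits of M.  As H is closed for the finite circuits, its indicator
-- function, viewed as a map to the matroid with one loop and one coloop, is
-- strong on each of the finite matroids of the diagram.  The colimit
-- property makes it strong on M, so that H is closed in M and contains e.
-- Hence e lies on a finite circuit contained in C, which must be C.

module Submission where

open import Defs
open import Level using (Level; suc; _⊔_; Lift; lift; lower)
open import Axiom.ExcludedMiddle using (ExcludedMiddle)
open import Data.Bool using (Bool; true; false)
open import Data.Irrelevant using ([_])
open import Data.List as List using (List; []; _∷_; _++_; filter; concatMap)
open import Data.List.Membership.Propositional using (mapWith∈; lose)
  renaming (_∈_ to _∈ₗ_)
open import Data.List.Membership.Propositional.Properties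
  using (∈-map⁺; ∈-++⁺ˡ; ∈-++⁺ʳ; ∈-filter⁺; ∈-filter⁻; ∈-concatMap⁺)
open import Data.List.Relation.Unary.Any using (here; there)
open import Data.List.Relation.Unary.Any.Properties using (mapWith∈⁺)
open import Data.Product using (∃; _×_; _,_; proj₁; proj₂)
open import Data.Refinement using (Refinement; value; _,_)
open import Data.Refinement.Properties using (value-injective)
open import Data.Sum using (_⊎_; inj₁; inj₂; map₁)
open import Data.Unit.Polymorphic using (⊤; tt)
open import Function using (_⇔_; mk⇔; Equivalence; _∘_; const)
open import Relation.Binary.PropositionalEquality
  using (_≡_; refl; sym; trans; cong; subst)
open import Relation.Nullary using (¬_; Dec; yes; no; does; contradiction; recompute)
open import Relation.Nullary.Decidable using (map′; decidable-stable; dec-true)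
open import Relation.Unary
  using (Pred; _∈_; _∉_; _⊆_; _≐_; _∪_; _∖_; ∅; U; ｛_｝)

private
  variable
    a b c d ℓ : Level

-- Images and preimages of subsets

≐-sym : {A : Set a} {X : Pred A b} {Y : Pred A c} → X ≐ Y → Y ≐ X
≐-sym (X⊆Y , Y⊆X) = Y⊆X , X⊆Y

module _ {A : Set a} {B : Set b} (f : A → B) where

  image-mono : {X : Pred A c} {Y : Pred A d} → X ⊆ Y → image f X ⊆ image f Y
  image-mono X⊆Y (x , x∈X , fx≡y) = x , X⊆Y x∈X , fx≡y

  image-preimage : {C : Pred B c} {Y : Pred A d} →
                   C ⊆ image f Y → image f (C ∘ f) ≐ C
  image-preimage {C = C} C⊆ =
    (λ { (_ , fx∈C , refl) → fx∈C }) ,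
    (λ y∈C → let x , _ , fx≡y = C⊆ y∈C in x , subst C (sym fx≡y) y∈C , fx≡y)

  image-reflect : (∀ {x y} → f x ≡ f y → x ≡ y) →
                  {X : Pred A c} {x : A} → f x ∈ image f X → x ∈ X
  image-reflect inj {X} (y , y∈X , fy≡fx) = subst X (inj fy≡fx) y∈X

-- Restriction along an injection

module _ (M : Matroid ℓ) {E′ : Set ℓ} (ι : E′ → Matroid.E M)
         (ι-injective : ∀ {x y} → ι x ≡ ι y → x ≡ y) where
  open Matroid M

  private
    reflect : {X : Pred E′ ℓ} {x : E′} → ι x ∈ image ι X → x ∈ X
    reflect = image-reflect ι ι-injective

    -- A circuit inside the image of `I` is the image of its own preimage, so it comes from a
    -- circuit of the restriction inside `I`.
    image-independent : {I : Pred E′ ℓ} →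
      (∀ {C} → Circuit (image ι C) → ¬ (C ⊆ I)) → Independent (image ι I)
    image-independent ind circ C⊆ =
      ind (C-resp-≐ (≐-sym (image-preimage ι C⊆)) circ) (reflect ∘ C⊆)

  restrict : Matroid ℓ
  restrict = record
    { E        = E′
    ; Circuit  = λ C → Circuit (image ι C)
    ; C-resp-≐ = λ (C⊆D , D⊆C) →
        C-resp-≐ (image-mono ι C⊆D , image-mono ι D⊆C)
    ; C0       = λ circ empty →
        C0 circ (λ { _ (x , x∈C , _) → empty x x∈C })
    ; CI       = λ circC circD C≠D C⊆D →
        CI circC circD
          (λ (ιC⊆ιD , ιD⊆ιC) → C≠D
            ( (λ x∈C → reflect (ιC⊆ιD (_ , x∈C , refl)))
            , (λ x∈D → reflect (ιD⊆ιC (_ , x∈D , refl)))))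
          (image-mono ι C⊆D)
    ; CE       = eliminate
    ; CM       = maximal
    }
    where
    eliminate : ∀ {C X : Pred E′ ℓ} → Circuit (image ι C) → X ⊆ C →
      (D : E′ → Pred E′ ℓ) →
      (∀ {x} → x ∈ X → Circuit (image ι (D x))) →
      (∀ {x y} → x ∈ X → y ∈ X → (x ∈ D y) ⇔ (x ≡ y)) →
      let ⋃D = λ w → ∃ λ x → x ∈ X × w ∈ D x in
      ∀ {z} → z ∈ C → z ∉ ⋃D →
      ∃ λ C′ → Circuit (image ι C′) × z ∈ C′ × C′ ⊆ (C ∪ ⋃D) ∖ X
    eliminate {C} {X} circC X⊆C D circD D∩X {z} z∈C z∉⋃D
      with CE circC (image-mono ι X⊆C) ιD circιD ιD∩ιX (z , z∈C , refl) ιz∉⋃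
      where
      -- `CE` asks for a family on all of `E`. Ranging over the preimages of `y` avoids deciding
      -- whether there is one; by injectivity the value at `ι x` is the image of `D x`.
      ιD : E → Pred E ℓ
      ιD y w = ∃ λ x → ι x ≡ y × w ∈ image ι (D x)

      ιD≐ : ∀ {x} → image ι (D x) ≐ ιD (ι x)
      ιD≐ {x} =
        (λ w∈ → x , refl , w∈) ,
        (λ (x′ , ιx′≡ιx , w∈) →
          subst (λ y → _ ∈ image ι (D y)) (ι-injective ιx′≡ιx) w∈)

      circιD : ∀ {y} → y ∈ image ι X → Circuit (ιD y)
      circιD (x , x∈X , refl) = C-resp-≐ ιD≐ (circD x∈X)

      ιD∩ιX : ∀ {x y} → x ∈ image ι X → y ∈ image ι X → (x ∈ ιD y) ⇔ (x ≡ y)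
      ιD∩ιX (x , x∈X , refl) (y , y∈X , refl) = mk⇔
        (λ x∈D → cong ι (to (reflect (proj₂ ιD≐ x∈D))))
        (λ x≡y → proj₁ ιD≐ (x , from (ι-injective x≡y) , refl))
        where open Equivalence (D∩X x∈X y∈X)

      ιz∉⋃ : ¬ (∃ λ y → y ∈ image ι X × ι z ∈ ιD y)
      ιz∉⋃ (_ , (x , x∈X , refl) , z∈) =
        z∉⋃D (x , x∈X , reflect (proj₂ ιD≐ z∈))
    ... | C′ , circ , z∈C′ , C′⊆ =
        C′ ∘ ι
      , C-resp-≐ (≐-sym (image-preimage ι {Y = U} C′⊆range)) circ
      , z∈C′
      , C′∘ι⊆
      where
      C′⊆range : C′ ⊆ image ι U
      C′⊆range w∈ with C′⊆ w∈
      ... | inj₁ (x , _ , p) , _ = x , _ , p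
      ... | inj₂ (_ , _ , _ , _ , x , _ , p) , _ = x , _ , p

      C′∘ι⊆ : C′ ∘ ι ⊆ (C ∪ (λ w → ∃ λ x → x ∈ X × w ∈ D x)) ∖ X
      C′∘ι⊆ w∈ with C′⊆ w∈
      ... | inj₁ w∈C , w∉X =
        inj₁ (reflect w∈C) , λ w∈X → w∉X (_ , w∈X , refl)
      ... | inj₂ (_ , (x , x∈X , refl) , x′ , ιx′≡ιx , w∈D) , w∉X =
        inj₂ (x , x∈X , subst (λ y → _ ∈ D y) (ι-injective ιx′≡ιx) (reflect w∈D)) ,
        λ w∈X → w∉X (_ , w∈X , refl)

    maximal : PropertyM {ℓ} {E = E′}
                (λ I → ∀ {C} → Circuit (image ι C) → ¬ (C ⊆ I))
    maximal {A} {S} indA A⊆S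
      with CM {image ι A} {image ι S} (image-independent indA) (image-mono ι A⊆S)
    ... | X , (indX , A⊆X , X⊆S) , X-max =
        X ∘ ι
      , ( (λ circ C⊆X → indX circ (λ { (_ , x∈C , refl) → C⊆X x∈C }))
        , (λ x∈A → A⊆X (_ , x∈A , refl))
        , (λ x∈X → reflect (X⊆S x∈X)))
      , λ { {Y} (indY , A⊆Y , Y⊆S) X⊆Y {y} y∈Y →
            X-max {image ι Y}
              (image-independent indY , image-mono ι A⊆Y , image-mono ι Y⊆S)
              -- `X` lies in the image of `S`, so the containment may be checked after pulling back
              -- along `ι`.
              (λ { w∈X → ⊆image {Y} X⊆Y (X⊆S w∈X) w∈X })
              (y , y∈Y , refl) }
      where
      ⊆image : ∀ {Y} → X ∘ ι ⊆ Y → ∀ {w} → w ∈ image ι S → w ∈ X → w ∈ image ι Y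
      ⊆image X⊆Y (x , _ , refl) x∈X = x , X⊆Y x∈X , refl

  cl-restrict : {Y : Pred E′ a} {C : Pred E ℓ} {x : E′} →
    Circuit C → ι x ∈ C → C ⊆ image ι (Y ∪ ｛ x ｝) → x ∈ Matroid.cl restrict Y
  cl-restrict {C = C} circ x∈C C⊆ =
    inj₂ (C ∘ ι , C-resp-≐ (≐-sym (image-preimage ι C⊆)) circ , x∈C
         , image-reflect ι ι-injective ∘ C⊆)

-- Circuit-preserving maps and loops

circuit-preserving⇒strong : (M N : Matroid ℓ) →
  let module M = Matroid M; module N = Matroid N in
  (f : M.E → N.E) → (∀ {C} → M.Circuit C → N.Circuit (image f C)) →
  ∀ (A : Pred M.E ℓ) → image f (M.cl A) ⊆ N.cl (image f A)
circuit-preserving⇒strong M N f pres A (x , inj₁ x∈A , refl) =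
  inj₁ (x , x∈A , refl)
circuit-preserving⇒strong M N f pres A (x , inj₂ (C , circ , x∈C , C⊆) , refl) =
  inj₂ (image f C , pres circ , (x , x∈C , refl) , fC⊆)
  where
  fC⊆ : image f C ⊆ image f A ∪ ｛ f x ｝
  fC⊆ (y , y∈C , refl) with C⊆ y∈C
  ... | inj₁ y∈A  = inj₁ (y , y∈A , refl)
  ... | inj₂ refl = inj₂ refl

loop-circuit : (M : Matroid ℓ) → let open Matroid M in
  ∀ {x} → x ∈ Loop → ∃ λ C → Circuit C × x ∈ C × C ⊆ ｛ x ｝
loop-circuit M (inj₂ (C , circ , x∈C , C⊆)) =
  C , circ , x∈C , λ y∈C → drop (C⊆ y∈C)
  where
  drop : ∀ {y} → y ∈ ∅ ∪ ｛ _ ｝ → y ∈ ｛ _ ｝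
  drop (inj₂ p) = p

-- Matroids all of whose elements are loops or coloops

module _ {E : Set ℓ} (L : Pred E ℓ) where

  private
    Circ : Pred (Pred E ℓ) ℓ
    Circ C = ∃ λ x → x ∈ L × C ≐ ｛ x ｝

    Indep : Pred (Pred E ℓ) (suc ℓ)
    Indep I = ∀ {C} → Circ C → ¬ (C ⊆ I)

  loops : Matroid ℓ
  loops = record
    { E        = E
    ; Circuit  = Circ
    ; C-resp-≐ = λ { (C⊆D , D⊆C) (x , x∈L , C⊆x , x⊆C) →
                     x , x∈L , C⊆x ∘ D⊆C , C⊆D ∘ x⊆C }
    ; C0       = λ { (x , _ , _ , x⊆C) empty → empty x (x⊆C refl) }
    ; CI       = incomparable
    ; CE       = eliminate
    ; CM       = maximal
    }
    where
    incomparable : ∀ {C D} → Circ C → Circ D → ¬ (C ≐ D) → ¬ (C ⊆ D)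
    incomparable (x , _ , C⊆x , x⊆C) (y , _ , D⊆y , y⊆D) C≠D C⊆D
      with refl ← D⊆y (C⊆D (x⊆C refl)) = C≠D (C⊆D , x⊆C ∘ D⊆y)

    eliminate : ∀ {C X : Pred E ℓ} → Circ C → X ⊆ C →
      (D : E → Pred E ℓ) →
      (∀ {x} → x ∈ X → Circ (D x)) →
      (∀ {x y} → x ∈ X → y ∈ X → (x ∈ D y) ⇔ (x ≡ y)) →
      let ⋃D = λ w → ∃ λ x → x ∈ X × w ∈ D x in
      ∀ {z} → z ∈ C → z ∉ ⋃D →
      ∃ λ C′ → Circ C′ × z ∈ C′ × C′ ⊆ (C ∪ ⋃D) ∖ X
    -- `C` itself serves, because `X` is empty: `C` is the singleton of `z`, so a member of `X`
    -- would be `z`, which then lies in `D z`.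
    eliminate {C} {X} circ@(_ , _ , C⊆x , _) X⊆C D _ D∩X {z} z∈C z∉⋃D =
      C , circ , z∈C , λ w∈C →
        inj₁ w∈C , λ w∈X →
          let z∈X = subst X (trans (sym (C⊆x w∈C)) (C⊆x z∈C)) w∈X
          in z∉⋃D (z , z∈X , Equivalence.from (D∩X z∈X z∈X) refl)

    avoids : ∀ {I} → Indep I → ∀ {x} → x ∈ I → x ∉ L
    avoids ind {x} x∈I x∈L =
      ind {｛ x ｝} (x , x∈L , (λ p → p) , (λ p → p)) (λ { refl → x∈I })

    maximal : PropertyM {ℓ} Indep
    maximal {A} {S} indA A⊆S =
        S ∖ L
      , ( (λ { (x , x∈L , _ , x⊆C) C⊆S∖L → proj₂ (C⊆S∖L (x⊆C refl)) x∈L })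
        , (λ x∈A → A⊆S x∈A , avoids indA x∈A)
        , proj₁)
      , λ { (indY , _ , Y⊆S) _ y∈Y → Y⊆S y∈Y , avoids indY y∈Y }

  loops-cl⁺ : {A : Pred E a} {x : E} → x ∈ L → x ∈ Matroid.cl loops A
  loops-cl⁺ {x = x} x∈L =
    inj₂ (｛ x ｝ , (x , x∈L , (λ p → p) , (λ p → p)) , refl , inj₂)

  loops-cl⁻ : {A : Pred E a} {x : E} → x ∈ Matroid.cl loops A → x ∈ A ∪ L
  loops-cl⁻ (inj₁ x∈A) = inj₁ x∈A
  loops-cl⁻ (inj₂ (_ , (_ , y∈L , C⊆y , _) , x∈C , _))
    with refl ← C⊆y x∈C = inj₂ y∈L

pointedLoops : {E : Set ℓ} (L : Pred E ℓ) {x : E} → x ∈ L → PointedMatroid ℓ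
pointedLoops L {x} x∈L = record
  { matroid = loops L
  ; ∗       = x
  ; ∗-loop  = loops-cl⁺ L x∈L
  }

module Classical {ℓ : Level} (em : ExcludedMiddle (suc ℓ)) where

  lem : (P : Set ℓ) → Dec P
  lem P = map′ lower lift (em {Lift (suc ℓ) P})

-- Finite subsets

  ⊆list⇒finite : {A : Set ℓ} {X : Pred A ℓ} (xs : List A) →
                 X ⊆ (_∈ₗ xs) → FiniteSubset X
  ⊆list⇒finite {X = X} xs X⊆ =
      filter X? xs
    , (λ x∈X → ∈-filter⁺ X? (X⊆ x∈X) x∈X)
    , (λ x∈ → proj₂ (∈-filter⁻ X? {xs = xs} x∈))
    where
    X? = λ x → lem (X x)

-- Finitary matroids are colimits of finite matroids

  module Forward (M : PointedMatroid ℓ) where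
    open PointedMatroid M

    -- The membership proof is irrelevant, which makes `value` injective even if an element occurs
    -- in the list more than once.
    Sub : List E → Set ℓ
    Sub xs = Refinement E (_∈ₗ (∗ ∷ xs))

    finite-Sub : ∀ xs → FiniteSet (Sub xs)
    finite-Sub xs =
        mapWith∈ (∗ ∷ xs) include
      , (λ { {x , [ p ]} _ → mapWith∈⁺ include
               (x , recompute (lem (x ∈ₗ (∗ ∷ xs))) p , refl) })
      , _
      where
      include : ∀ {x} → x ∈ₗ (∗ ∷ xs) → Sub xs
      include {x} x∈ = x , [ x∈ ]

    ∗∈ : ∀ xs → Sub xs
    ∗∈ xs = ∗ , [ here refl ]

    restrictTo : List E → PointedMatroid ℓ
    restrictTo xs = record
      { matroid = restrict matroid (value {P = _∈ₗ (∗ ∷ xs)}) value-injective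
      ; ∗       = ∗∈ xs
      ; ∗-loop  =
          let C , circ , ∗∈C , C⊆ = loop-circuit matroid ∗-loop
          in cl-restrict matroid value value-injective circ ∗∈C
               (λ y∈C → ∗∈ xs , inj₂ refl , C⊆ y∈C)
      }

    embed : ∀ xs → PointedStrongMap (restrictTo xs) M
    embed xs = record
      { map     = value
      ; strong  = circuit-preserving⇒strong
                    (PointedMatroid.matroid (restrictTo xs)) matroid value
                    (λ circ → circ)
      ; pointed = refl
      }

    -- The finite sets containing the point, preordered by inclusion. Lists represent them in the
    -- universe of ground sets, where predicates would not fit.
    J : Category ℓ ℓ ℓ
    J = record
      { Obj       = List E
      ; _⇒_       = λ xs ys → ∀ {x} → x ∈ₗ (∗ ∷ xs) → x ∈ₗ (∗ ∷ ys)
      ; _≈_       = λ _ _ → ⊤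
      ; idn       = λ x∈ → x∈
      ; _∙_       = λ g f x∈ → g (f x∈)
      ; equiv     = _
      ; ∙-resp-≈  = _
      ; assoc     = _
      ; identityˡ = _
      ; identityʳ = _
      }

    transport : ∀ {xs ys} → (∀ {x} → x ∈ₗ (∗ ∷ xs) → x ∈ₗ (∗ ∷ ys)) →
                PointedStrongMap (restrictTo xs) (restrictTo ys)
    transport {xs} {ys} xs⊆ys = record
      { map     = include
      ; strong  = circuit-preserving⇒strong
                    (PointedMatroid.matroid (restrictTo xs))
                    (PointedMatroid.matroid (restrictTo ys)) include
                    (C-resp-≐
                      ( (λ { (_ , x∈C , refl) → _ , (_ , x∈C , refl) , refl })
                      , (λ { (_ , (_ , x∈C , refl) , refl) → _ , x∈C , refl })))
      ; pointed = refl
      }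
      where
      include : Sub xs → Sub ys
      include (x , [ p ]) = x , [ xs⊆ys p ]

    F : Functor J (Mat• ℓ)
    F = record
      { F₀       = restrictTo
      ; F₁       = transport
      ; F-resp-≈ = λ _ _ → refl
      ; F-idn    = λ _ → refl
      ; F-∙      = λ _ → refl
      }

    κ : Cocone F M
    κ = record { leg = embed ; commute = λ _ _ → refl }

    module _ (fin : Finitary) {N : PointedMatroid ℓ} (μ : Cocone F N) where
      open Cocone μ
      module N = PointedMatroid N
      open PointedStrongMap

      u : E → N.E
      u x = map (leg (x ∷ [])) (x , [ there (here refl) ])

      -- The stage `x ∷ []` is included in every stage containing `x`, so the two legs agree at `x`
      -- by commutation.
      u-factors : ∀ xs (s : Sub xs) → u (value s) ≡ map (leg xs) s
      u-factors xs (x , [ p ]) = sym (commute x⊆xs _)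
        where
        x⊆xs : ∀ {y} → y ∈ₗ (∗ ∷ x ∷ []) → y ∈ₗ (∗ ∷ xs)
        x⊆xs (here refl)         = here refl
        x⊆xs (there (here refl)) = recompute (lem (x ∈ₗ (∗ ∷ xs))) p

      -- A finite circuit lies in the stage that lists its elements; the closure is witnessed there,
      -- and the leg at that stage is strong.
      u-strong : ∀ (A : Pred E ℓ) → image u (cl A) ⊆ N.cl (image u A)
      u-strong A (x , inj₁ x∈A , refl) = inj₁ (x , x∈A , refl)
      u-strong A (x , inj₂ (C , circ , x∈C , C⊆) , refl) =
        N.cl-mono
          (λ { (s , s∈A , refl) → value s , s∈A , u-factors xs s })
          (strong (leg xs) A∩xs (x′ , x′∈cl , sym (u-factors xs x′)))
        where
        xs = proj₁ (fin circ)

        A∩xs : Pred (Sub xs) ℓ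
        A∩xs s = value s ∈ A

        include : ∀ {y} → y ∈ C → Sub xs
        include {y} y∈C = y , [ there (proj₁ (proj₂ (fin circ)) y∈C) ]

        x′ : Sub xs
        x′ = include x∈C

        C⊆′ : C ⊆ image value (A∩xs ∪ ｛ x′ ｝)
        C⊆′ y∈C with C⊆ y∈C
        ... | inj₁ y∈A  = include y∈C , inj₁ y∈A , refl
        ... | inj₂ refl = include y∈C , inj₂ refl , refl

        x′∈cl : x′ ∈ PointedMatroid.cl (restrictTo xs) A∩xs
        x′∈cl = cl-restrict matroid value value-injective circ x∈C C⊆′

      universal : PointedStrongMap M N
      universal = record
        { map     = u
        ; strong  = u-strong
        ; pointed = trans (u-factors [] (∗∈ [])) (pointed (leg []))
        }

    finitary⇒colimit : Finitary → IsColimitOfFinite M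
    finitary⇒colimit fin = J , F , finite-Sub , κ , λ μ →
      -- Uniqueness: the value of a factoring map at `x` is forced by the leg at `x ∷ []`.
      universal fin μ , u-factors fin μ , λ v v-factors x → v-factors (x ∷ []) _

-- Closure under finite circuits

  module _ (M : Matroid ℓ) where
    open Matroid M

    FinCircuit : Pred (Pred E ℓ) ℓ
    FinCircuit C = Circuit C × FiniteSubset C

    SpannedBy : Pred E a → Pred E (suc ℓ ⊔ a)
    SpannedBy X x = ∃ λ C → FinCircuit C × x ∈ C × C ⊆ X ∪ ｛ x ｝

    -- Elements are adjoined only once; by `finCl-closed` a second round adds nothing.
    finCl : Pred E a → Pred E (suc ℓ ⊔ a)
    finCl X = X ∪ SpannedBy X

    private
      -- Junk value ｛ y ｝ when no finite circuit is available.
      spanning : (A : Pred E ℓ) (y : E) → ∃ λ C → FiniteSubset C ×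
        (y ∈ SpannedBy A → Circuit C × y ∈ C × C ⊆ A ∪ ｛ y ｝)
      spanning A y with em {SpannedBy A y}
      ... | yes (C , (circ , finC) , y∈C , C⊆) = C , finC , λ _ → circ , y∈C , C⊆
      ... | no  ¬span =
        ｛ y ｝ , ⊆list⇒finite (y ∷ []) (λ { refl → here refl }) ,
        λ span → contradiction span ¬span

    -- The infinite elimination axiom removes D ∖ (A ∪ {x}) at once, so no
    -- induction on the size of D is needed.
    finCl-closed : (A : Pred E ℓ) → SpannedBy (finCl A) ⊆ finCl A
    finCl-closed A {x} (D , (circD , ds , D⊆ds , _) , x∈D , D⊆)
      with lem (x ∈ A)
    ... | yes x∈A = inj₁ x∈A
    ... | no  x∉A
      with CE circD proj₁ (λ y → proj₁ (spanning A y))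
             (λ y∈X → proj₁ (spans y∈X)) meet x∈D x∉⋃
      where
      X : Pred E ℓ
      X y = y ∈ D × y ∉ A × ¬ (x ≡ y)

      spans : ∀ {y} → y ∈ X → let C = proj₁ (spanning A y) in
              Circuit C × y ∈ C × C ⊆ A ∪ ｛ y ｝
      spans {y} (y∈D , y∉A , x≢y) with D⊆ y∈D
      ... | inj₁ (inj₁ y∈A)  = contradiction y∈A y∉A
      ... | inj₁ (inj₂ span) = proj₂ (proj₂ (spanning A y)) span
      ... | inj₂ x≡y         = contradiction x≡y x≢y

      -- The circuit chosen for `z` lies in `A ∪ ｛ z ｝` and `X` avoids `A`, so it meets `X` in `z`
      -- alone.
      meet : ∀ {y z} → y ∈ X → z ∈ X → (y ∈ proj₁ (spanning A z)) ⇔ (y ≡ z)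
      meet {y} {z} (_ , y∉A , _) z∈X = mk⇔ to (λ { refl → proj₁ (proj₂ (spans z∈X)) })
        where
        to : y ∈ proj₁ (spanning A z) → y ≡ z
        to y∈ with proj₂ (proj₂ (spans z∈X)) y∈
        ... | inj₁ y∈A = contradiction y∈A y∉A
        ... | inj₂ z≡y = sym z≡y

      x∉⋃ : ¬ (∃ λ y → y ∈ X × x ∈ proj₁ (spanning A y))
      x∉⋃ (y , y∈X@(_ , _ , x≢y) , x∈) with proj₂ (proj₂ (spans y∈X)) x∈
      ... | inj₁ x∈A = x∉A x∈A
      ... | inj₂ y≡x = x≢y (sym y≡x)
    ... | C′ , circ , x∈C′ , C′⊆ =
      inj₂ (C′ , (circ , ⊆list⇒finite (ds ++ concatMap list ds) C′⊆list) , x∈C′ , C′⊆A)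
      where
      list : E → List E
      list y = proj₁ (proj₁ (proj₂ (spanning A y)))

      -- `C′` lies in a finite union of finite sets; junk values at entries of `ds` outside `X` only
      -- lengthen the list.
      C′⊆list : C′ ⊆ (_∈ₗ (ds ++ concatMap list ds))
      C′⊆list w∈ with C′⊆ w∈
      ... | inj₁ w∈D , _ = ∈-++⁺ˡ (D⊆ds w∈D)
      ... | inj₂ (y , (y∈D , _) , w∈C) , _ =
        ∈-++⁺ʳ ds (∈-concatMap⁺ list
          (lose (D⊆ds y∈D) (proj₁ (proj₂ (proj₁ (proj₂ (spanning A y)))) w∈C)))

      C′⊆A : C′ ⊆ A ∪ ｛ x ｝
      C′⊆A {w} w∈ with lem (w ∈ A) | lem (x ≡ w)
      ... | yes w∈A | _       = inj₁ w∈A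
      ... | no  _   | yes x≡w = inj₂ x≡w
      -- Such a `w` would lie in `X`, which `C′` avoids: either `w ∈ D`, or `w` lies in the circuit
      -- chosen for some `y ∈ X`, which forces `w` to be `y`.
      ... | no  w∉A | no  x≢w with C′⊆ w∈
      ... | inj₁ w∈D , w∉X = contradiction (w∈D , w∉A , x≢w) w∉X
      ... | inj₂ (y , (y∈D , y∉A , x≢y) , w∈C) , w∉X
        with D⊆ y∈D
      ... | inj₁ (inj₁ y∈A)  = contradiction y∈A y∉A
      ... | inj₂ x≡y         = contradiction x≡y x≢y
      ... | inj₁ (inj₂ span) with proj₂ (proj₂ (proj₂ (proj₂ (spanning A y)) span)) w∈C
      ... | inj₁ w∈A  = inj₁ w∈A
      ... | inj₂ refl = contradiction (y∈D , w∉A , x≢w) w∉X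

-- Colimits of finite matroids are finitary

  𝟚 : Set ℓ
  𝟚 = Lift ℓ Bool

  -- Excluded middle turns a predicate of the higher level into a function between ground sets.
  indicator : {A : Set ℓ} → Pred A (suc ℓ) → A → 𝟚
  indicator P x = lift (does (em {P x}))

  module _ {A : Set ℓ} (P : Pred A (suc ℓ)) {x : A} where

    indicator⁺ : x ∈ P → indicator P x ≡ lift true
    indicator⁺ x∈P = cong lift (dec-true em x∈P)

    indicator⁻ : indicator P x ≡ lift true → x ∈ P
    indicator⁻ eq with em {P x}
    ... | yes x∈P = x∈P

    indicator-∉ : x ∉ P → indicator P x ≡ lift false
    indicator-∉ x∉P with em {P x}
    ... | yes x∈P = contradiction x∈P x∉P
    ... | no  _   = refl

  module Backward (M : PointedMatroid ℓ) {J : Category ℓ ℓ ℓ}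
                  (F : Functor J (Mat• ℓ))
                  (fin : ∀ j → PointedMatroid.Finite (Functor.F₀ F j))
                  (κ : Cocone F M) (colim : IsColimiting F κ) where
    open PointedMatroid M
    open PointedStrongMap
    open Cocone κ
    private module F j = PointedMatroid (Functor.F₀ F j)

    -- Adjoining `∗` makes the indicator pointed even when the diagram is empty.
    Range : Pred E (suc ℓ)
    Range y = Lift (suc ℓ) (y ≡ ∗ ⊎ ∃ λ j → ∃ λ s → map (leg j) s ≡ y)

    -- Two maps into a matroid of loops, both strong for trivial reasons,
    -- which agree on Range only.
    jointly-surjective : ∀ x → x ∈ Range
    jointly-surjective x =
      indicator⁻ Range (trans (all≈u Range-map Range-factors x)
                              (sym (all≈u true-map (λ _ _ → refl) x)))
      where
      N : PointedMatroid ℓ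
      N = pointedLoops {E = 𝟚} (λ _ → ⊤) {lift true} tt

      into-N : {K : PointedMatroid ℓ} (f : PointedMatroid.E K → 𝟚) →
               f (PointedMatroid.∗ K) ≡ lift true → PointedStrongMap K N
      into-N f f∗ = record
        { map = f ; strong = λ _ _ → loops-cl⁺ (λ _ → ⊤) tt ; pointed = f∗ }

      μ : Cocone F N
      μ = record
        { leg     = λ j → into-N (const (lift true)) refl
        ; commute = λ _ _ → refl
        }

      all≈u : ∀ v → Factors F κ μ v → ∀ x → map v x ≡ map (proj₁ (colim μ)) x
      all≈u = proj₂ (proj₂ (colim μ))

      true-map Range-map : PointedStrongMap M N
      true-map  = into-N (const (lift true)) refl
      Range-map = into-N (indicator Range) (indicator⁺ Range (lift (inj₁ refl)))

      Range-factors : Factors F κ μ Range-map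
      Range-factors j s = indicator⁺ Range (lift (inj₂ (j , s , refl)))

    module _ (A : Pred E ℓ) where

      private
        H : Pred E (suc ℓ)
        H = finCl matroid A

        χ : E → 𝟚
        χ = indicator H

        L : Pred 𝟚 ℓ
        L = ｛ lift true ｝

        N : PointedMatroid ℓ
        N = pointedLoops L refl

        ∗∈H : ∗ ∈ H
        ∗∈H = let C , circ , ∗∈C , C⊆ = loop-circuit matroid ∗-loop in
          inj₂ (C , (circ , ⊆list⇒finite (∗ ∷ []) (λ y∈C → here (sym (C⊆ y∈C))))
               , ∗∈C , inj₂ ∘ C⊆)

        -- A circuit of `M` witnessing the closure lies in the image of a finite ground set plus one
        -- element. It is therefore finite, and `finCl-closed` applies.
        H-closed-in-legs : ∀ j (B : Pred (F.E j) ℓ) → image (map (leg j)) B ⊆ H →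
                           image (map (leg j)) (F.cl j B) ⊆ H
        H-closed-in-legs j B B⊆H x∈cl with strong (leg j) B x∈cl
        ... | inj₁ x∈B = B⊆H x∈B
        ... | inj₂ (C , circ , x∈C , C⊆) =
          finCl-closed matroid A
            (C , (circ , ⊆list⇒finite (_ ∷ List.map (map (leg j)) xs) C⊆list)
               , x∈C , map₁ B⊆H ∘ C⊆)
          where
          xs = proj₁ (fin j)

          C⊆list : C ⊆ (_∈ₗ (_ ∷ List.map (map (leg j)) xs))
          C⊆list w∈C with C⊆ w∈C
          ... | inj₁ (s , _ , refl) =
            there (∈-map⁺ (map (leg j)) (proj₁ (proj₂ (fin j)) _))
          ... | inj₂ refl = here refl

        μ-leg : ∀ j → PointedStrongMap (Functor.F₀ F j) N
        μ-leg j = record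
          { map     = χ ∘ map (leg j)
          ; strong  = strong′
          ; pointed = trans (cong χ (pointed (leg j))) (indicator⁺ H ∗∈H)
          }
          where
          strong′ : ∀ B → image (χ ∘ map (leg j)) (F.cl j B) ⊆
                          PointedMatroid.cl N (image (χ ∘ map (leg j)) B)
          -- Closure in `N` always contains `true`, so only the value `false` needs a witness in
          -- `B`. Without one, `B` maps into `H`, and then so does its closure.
          strong′ B (s , s∈cl , refl)
            with em {H (map (leg j) s)} | lem (∃ λ t → t ∈ B × χ (map (leg j) t) ≡ lift false)
          ... | yes s∈H | _ = loops-cl⁺ L refl
          ... | no  s∉H | yes (t , t∈B , χt) = inj₁ (t , t∈B , χt)
          ... | no  s∉H | no  B⊆H =
            contradiction
              (H-closed-in-legs j B
                (λ { (t , t∈B , refl) →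
                     decidable-stable em λ t∉H → B⊆H (t , t∈B , indicator-∉ H t∉H) })
                (s , s∈cl , refl))
              s∉H

        μ : Cocone F N
        μ = record { leg = μ-leg ; commute = λ f s → cong χ (commute f s) }

        u : PointedStrongMap M N
        u = proj₁ (colim μ)

        -- As `χ` is not yet known to be strong on `M`, uniqueness cannot be applied to it. But `u`
        -- and `χ` agree at `∗` and along the legs, which together cover `E`.
        u≈χ : ∀ x → map u x ≡ χ x
        u≈χ x with lower (jointly-surjective x)
        ... | inj₁ refl           = trans (pointed u) (sym (indicator⁺ H ∗∈H))
        ... | inj₂ (j , s , refl) = proj₁ (proj₂ (colim μ)) j s

      -- The map `u` is strong and sends `A` to `true`, and closing up in `N` adds no value but
      -- `true`.
      cl⊆finCl : cl A ⊆ finCl matroid A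
      cl⊆finCl {x} x∈cl =
        indicator⁻ H (trans (sym (u≈χ x)) (true! (loops-cl⁻ L (strong u A (x , x∈cl , refl)))))
        where
        true! : ∀ {y} → y ∈ image (map u) A ∪ L → y ≡ lift true
        true! (inj₁ (a , a∈A , refl)) = trans (u≈χ a) (indicator⁺ H (inj₁ a∈A))
        true! (inj₂ refl)             = refl

    finitary : Finitary
    finitary {C} circ with lem (∃ (_∈ C))
    ... | no  empty     = contradiction (λ x x∈C → empty (x , x∈C)) (C0 circ)
    ... | yes (e , e∈C) = from-finCl (cl⊆finCl C∖e (inj₂ (C , circ , e∈C , split)))
      where
      C∖e : Pred E ℓ
      C∖e = C ∖ ｛ e ｝

      split : C ⊆ C∖e ∪ ｛ e ｝
      split {y} y∈C with lem (e ≡ y)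
      ... | yes e≡y = inj₂ e≡y
      ... | no  e≢y = inj₁ (y∈C , e≢y)

      from-finCl : e ∈ finCl matroid C∖e → FiniteSubset C
      from-finCl (inj₁ (_ , e≢e)) = contradiction refl e≢e
      from-finCl (inj₂ (D , (circD , ds , D⊆ds , _) , e∈D , D⊆)) =
        ⊆list⇒finite ds (D⊆ds ∘ proj₂ C≐D)
        where
        D⊆C : D ⊆ C
        D⊆C y∈D with D⊆ y∈D
        ... | inj₁ (y∈C , _) = y∈C
        ... | inj₂ refl      = e∈C

        C≐D : D ≐ C
        -- `CI` only refutes distinctness of the nested circuits, so equality comes from double
        -- negation elimination.
        C≐D = decidable-stable (lem (D ≐ C)) λ D≠C → CI circD circ D≠C D⊆C

corollary4p4 : ∀ {ℓ : Level} → ExcludedMiddle (suc ℓ) →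
    (M : PointedMatroid ℓ) → PointedMatroid.Finitary M ⇔ IsColimitOfFinite M
corollary4p4 em M = mk⇔ (Forward.finitary⇒colimit M) from
  where
  open Classical em

  from : IsColimitOfFinite M → PointedMatroid.Finitary M
  from (_ , F , fin , κ , colim) = Backward.finitary M F fin κ colim
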